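{- For all positive integers $k,r$ there exists a constant $C=C(k,r)$ such that the following holds. For every $n$, every complete graph on $n$ vertices whose edges are assigned weights in $\{0,1,\ldots,r\}$ contains a complete subgraph (induced on some vertex subset) with at least $n-C$ vertices whose repetition number is at least $\min\{k,n-C\}$.
   Context: For a complete graph with integer edge weights, the (weighted) degree of a vertex $v$ in a given (complete) subgraph is the sum of the weights of the edges of that subgraph incident with $v$. The repetition number of an edge-weighted graph is the maximum multiplicity of a value in its multiset of vertex degrees, i.e. the maximum number of vertices sharing the same degree. Degrees and repetition number of the subgraph are computed within the subgraph. -}

module Defs where

open import Data.Nat using (ℕ; suc; _⊔_)
open import Data.Fin using (Fin; toℕ; _≟_)
open import Data.List using (List; filter; map; length; foldr; allFin)
open import Data.Nat.ListAction using (sum)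
open import Data.Bool using (true; false)
open import Data.Vec using (lookup)
open import Data.Fin.Subset using (Subset)
open import Relation.Nullary using (¬_)
open import Relation.Nullary.Decidable using (¬?)
open import Relation.Binary.PropositionalEquality using (_≡_)
import Data.Nat as ℕ

-- An edge-weighting of the complete graph K_n with weights in {0,…,r}:
-- a symmetric function on pairs of vertices (diagonal values are ignored).
record Weighting (n r : ℕ) : Set where
  field
    w   : Fin n → Fin n → Fin (suc r)
    sym : ∀ i j → w i j ≡ w j i
open Weighting public

members : ∀ {n} → Subset n → List (Fin n)
members {n} S = filter (λ i → lookup S i Data.Bool.≟ true) (allFin n)

degree : ∀ {n r} → Weighting n r → Subset n → Fin n → ℕ
degree W S v = sum (map (λ u → toℕ (w W v u)) (filter (λ u → ¬? (u ≟ v)) (members S)))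

multiplicity : ∀ {n r} → Weighting n r → Subset n → ℕ → ℕ
multiplicity W S d = length (filter (λ u → degree W S u ℕ.≟ d) (members S))

-- repetition number of the induced subgraph on S:
-- maximum multiplicity of a value in the multiset of degrees (0 if S is empty)
repetitionNumber : ∀ {n r} → Weighting n r → Subset n → ℕ
repetitionNumber W S = foldr (λ v m → multiplicity W S (degree W S v) ⊔ m) 0 (members S)

{-# OPTIONS --safe #-}
-- By pigeonhole on windows of bounded length, many vertices have nearly equal degrees, and Ramsey's
-- theorem finds among them a monochromatic clique K of more than k vertices; inside K all degrees agree.
-- Fix v₀ in K. Each outside vertex u carries the bounded integer vector (w(v,u) − w(v₀,u)), v in K, and
-- the sum of these vectors is bounded. It then suffices to delete a bounded number of outside
-- vertices so that the remaining vectors sum to zero. In dimension one, order the integers so that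
-- all partial sums stay in a fixed interval and erase loops: what is left is a short list, and the
-- loops are short zero-sum blocks. In higher dimension, treat the blocks as the new vectors and
-- induct on the remaining coordinates.
module Submission where

open import Defs hiding (sym)
open import Data.Nat using (ℕ; suc; _≤_; _∸_; _⊓_)
open import Data.Product using (Σ; _×_)
open import Data.Fin.Subset using (Subset; ∣_∣)

open import Data.Bool using (true; false)
open import Data.Fin using (Fin; toℕ; _≟_)
open import Data.Integer using (ℤ; +_; -[1+_]; 0ℤ; -_; _+_; +≤+; -≤-)
open import Data.List using (List; []; _∷_; _++_; length; map; filter; concat; upTo; foldr; allFin; tabulate)
open import Data.List.Membership.Propositional using (_∈_)
open import Data.List.Membership.Propositional.Properties using (∈-∃++; ∈-++⁺ˡ; ∈-++⁺ʳ; ∈-++⁻; ∈-map⁺; ∈-upTo⁺)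
open import Data.List.Relation.Binary.Permutation.Propositional using (_↭_; ↭-refl; ↭-sym; ↭-trans; ↭-reflexive; prep; ↭⇒↭ₛ)
open import Data.List.Relation.Unary.All using (All; []; _∷_)
open import Data.List.Relation.Unary.AllPairs using (AllPairs; []; _∷_)
open import Data.List.Relation.Unary.Any using (here; there)
open import Data.List.Relation.Unary.Unique.Propositional using (Unique)
open import Data.Nat using (zero; z≤n; s≤s; _<_; _⊔_; NonZero)
open import Data.Nat.DivMod using (_/_; m≡m%n+[m/n]*n; m%n≤n; m/n*n≤m; /-monoˡ-≤)
open import Data.Nat.ListAction using (sum)
open import Data.Nat.Tactic.RingSolver using (solve-∀)
open import Data.Product using (∃; ∃₂; _,_; proj₁; proj₂)
open import Data.Sum using (inj₁; inj₂)
open import Data.Vec using (lookup)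
open import Function using (_∘_; id)
open import Level using (0ℓ)
open import Relation.Binary using (Symmetric; Rel)
open import Relation.Binary.PropositionalEquality using (_≡_; _≢_; refl; sym; trans; cong; cong₂; subst; setoid; module ≡-Reasoning)
open import Relation.Nullary using (Dec; yes; no; contradiction; does)
open import Relation.Nullary.Decidable using (¬?; dec-true; dec-false)
open import Relation.Unary using (Pred; Decidable)
import Data.Bool as Bool
import Data.Fin.Properties as Finₚ
import Data.Fin.Subset as Subset
import Data.Integer as ℤ
import Data.Integer.Properties as ℤₚ
import Data.List.Properties as Listₚ
import Data.List.Relation.Binary.Permutation.Propositional as ↭
import Data.List.Relation.Binary.Permutation.Propositional.Properties as ↭ₚ
import Data.List.Relation.Binary.Permutation.Setoid.Properties as ↭ₛₚ
import Data.List.Relation.Unary.All as All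
import Data.List.Relation.Unary.All.Properties as Allₚ
import Data.List.Relation.Unary.AllPairs.Properties as AllPairsₚ
import Data.List.Relation.Unary.Unique.Propositional.Properties as Uniqueₚ
import Data.Nat as ℕ
import Data.Nat.ListAction.Properties as Sumₚ
import Data.Nat.Properties as ℕₚ
import Data.Product as Product
import Data.Vec as Vec
import Data.Vec.Properties as Vecₚ
open import Algebra.Properties.AbelianGroup ℤₚ.+-0-abelianGroup using (identityʳ-unique; xyx⁻¹≈y; ⁻¹-anti-homo‿-; x∙y⁻¹≈ε⇒x≈y)
open import Algebra.Properties.CommutativeSemigroup ℤₚ.+-commutativeSemigroup using (interchange)
open import Data.List.Membership.DecPropositional ℤ._≟_ using () renaming (_∈?_ to _∈ℤ?_)

private
  variable
    A : Set

-- Permutations, concatenations and repetition-free lists.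

filter-split : {P : Pred A 0ℓ} (P? : Decidable P) (xs : List A) →
  xs ↭ filter P? xs ++ filter (¬? ∘ P?) xs
filter-split P? []       = ↭-refl
filter-split P? (x ∷ xs) with P? x
... | yes _ = prep x (filter-split P? xs)
... | no  _ = ↭-trans (prep x (filter-split P? xs))
                (↭-sym (↭ₚ.shift x (filter P? xs) (filter (¬? ∘ P?) xs)))

concat-↭ : {xss yss : List (List A)} → xss ↭ yss → concat xss ↭ concat yss
concat-↭ ↭.refl                   = ↭-refl
concat-↭ (prep xs p)              = ↭ₚ.++⁺ˡ xs (concat-↭ p)
concat-↭ {yss = _ ∷ _ ∷ yss} (↭.swap xs ys p) =
  ↭-trans (↭ₚ.++⁺ˡ xs (↭ₚ.++⁺ˡ ys (concat-↭ p))) (↭ₚ.shifts xs ys {concat yss})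
concat-↭ (↭.trans p q)            = ↭-trans (concat-↭ p) (concat-↭ q)

length-concat-≤ : ∀ L (xss : List (List A)) → All (λ xs → length xs ≤ L) xss →
  length (concat xss) ≤ length xss ℕ.* L
length-concat-≤ L []         []       = z≤n
length-concat-≤ L (xs ∷ xss) (p ∷ ps) =
  subst (_≤ _) (sym (Listₚ.length-++ xs)) (ℕₚ.+-mono-≤ p (length-concat-≤ L xss ps))

-- Each head is cut out of `ys` at one occurrence; uniqueness keeps the tail inside what remains.
-- Applied to an interval, this bounds walks that never repeat a position.
unique-⊆-length : {xs ys : List A} → Unique xs → All (_∈ ys) xs → length xs ≤ length ys
unique-⊆-length [] [] = z≤n
unique-⊆-length {xs = x ∷ xs} (x∉xs ∷ uxs) (x∈ys ∷ xs⊆ys) with ∈-∃++ x∈ys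
... | as , bs , refl = subst (suc (length xs) ≤_) (sym (↭ₚ.↭-length (↭ₚ.shift x as bs)))
    (s≤s (unique-⊆-length uxs (All.zipWith avoid (x∉xs , xs⊆ys))))
  where
  avoid : ∀ {y} → (x ≢ y) × (y ∈ as ++ x ∷ bs) → y ∈ as ++ bs
  avoid (x≢y , y∈) with ∈-++⁻ as y∈
  ... | inj₁ y∈as          = ∈-++⁺ˡ y∈as
  ... | inj₂ (here y≡x)    = contradiction (sym y≡x) x≢y
  ... | inj₂ (there y∈bs)  = ∈-++⁺ʳ as y∈bs

-- Integer sums over lists and symmetric intervals.

i≤i+nonneg : ∀ i {j} → 0ℤ ℤ.≤ j → i ℤ.≤ i + j
i≤i+nonneg i {j} 0≤j = subst (ℤ._≤ (i + j)) (ℤₚ.+-identityʳ i) (ℤₚ.+-monoʳ-≤ i 0≤j)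

i+nonpos≤i : ∀ i {j} → j ℤ.≤ 0ℤ → i + j ℤ.≤ i
i+nonpos≤i i {j} j≤0 = subst ((i + j) ℤ.≤_) (ℤₚ.+-identityʳ i) (ℤₚ.+-monoʳ-≤ i j≤0)

sumBy : (A → ℤ) → List A → ℤ
sumBy f []       = 0ℤ
sumBy f (x ∷ xs) = f x + sumBy f xs

sumBy-++ : (f : A → ℤ) (xs ys : List A) → sumBy f (xs ++ ys) ≡ sumBy f xs + sumBy f ys
sumBy-++ f []       ys = sym (ℤₚ.+-identityˡ _)
sumBy-++ f (x ∷ xs) ys = trans (cong (_+_ (f x)) (sumBy-++ f xs ys)) (sym (ℤₚ.+-assoc (f x) _ _))

sumBy-concat : (f : A → ℤ) (xss : List (List A)) → sumBy f (concat xss) ≡ sumBy (sumBy f) xss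
sumBy-concat f []         = refl
sumBy-concat f (xs ∷ xss) = trans (sumBy-++ f xs (concat xss)) (cong (_+_ (sumBy f xs)) (sumBy-concat f xss))

sumBy-↭ : (f : A → ℤ) {xs ys : List A} → xs ↭ ys → sumBy f xs ≡ sumBy f ys
sumBy-↭ f ↭.refl        = refl
sumBy-↭ f (prep x p)    = cong (_+_ (f x)) (sumBy-↭ f p)
sumBy-↭ f (↭.swap {ys = zs} x y p) = trans (cong (λ s → f x + (f y + s)) (sumBy-↭ f p))
  (trans (sym (ℤₚ.+-assoc (f x) (f y) _))
  (trans (cong (_+ sumBy f zs) (ℤₚ.+-comm (f x) (f y))) (ℤₚ.+-assoc (f y) (f x) _)))
sumBy-↭ f (↭.trans p q) = trans (sumBy-↭ f p) (sumBy-↭ f q)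

sumBy-≥0 : (f : A → ℤ) {xs : List A} → All (λ x → 0ℤ ℤ.≤ f x) xs → 0ℤ ℤ.≤ sumBy f xs
sumBy-≥0 f []       = ℤₚ.≤-refl
sumBy-≥0 f (p ∷ ps) = ℤₚ.+-mono-≤ p (sumBy-≥0 f ps)

sumBy-≤0 : (f : A → ℤ) {xs : List A} → All (λ x → f x ℤ.≤ 0ℤ) xs → sumBy f xs ℤ.≤ 0ℤ
sumBy-≤0 f []       = ℤₚ.≤-refl
sumBy-≤0 f (p ∷ ps) = ℤₚ.+-mono-≤ p (sumBy-≤0 f ps)

Within : ℕ → ℤ → Set
Within R p = (- (+ R) ℤ.≤ p) × (p ℤ.≤ + R)

within-0 : ∀ R → Within R 0ℤ
within-0 R = ℤₚ.neg-mono-≤ (+≤+ (z≤n {R})) , +≤+ z≤n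

within-+ : ∀ R S {p q} → Within R p → Within S q → Within (R ℕ.+ S) (p + q)
within-+ R S (a , b) (c , d) =
  subst (ℤ._≤ _) (sym (ℤₚ.neg-distrib-+ (+ R) (+ S))) (ℤₚ.+-mono-≤ a c) , ℤₚ.+-mono-≤ b d

within-neg : ∀ R {p} → Within R p → Within R (- p)
within-neg R (a , b) = ℤₚ.neg-mono-≤ b , subst (_ ℤ.≤_) (ℤₚ.neg-involutive (+ R)) (ℤₚ.neg-mono-≤ a)

within-mono : ∀ {R S p} → R ≤ S → Within R p → Within S p
within-mono R≤S (a , b) = ℤₚ.≤-trans (ℤₚ.neg-mono-≤ (+≤+ R≤S)) a , ℤₚ.≤-trans b (+≤+ R≤S)

sumBy-within : ∀ R (f : A → ℤ) {xs} → All (Within R ∘ f) xs → Within (length xs ℕ.* R) (sumBy f xs)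
sumBy-within R f []               = within-0 0
sumBy-within R f {x ∷ xs} (p ∷ ps) = within-+ R (length xs ℕ.* R) p (sumBy-within R f ps)

-- Enumerated as a list because its length, `2R + 1`, serves as the bound on simple walks and on
-- loops.
interval : ℕ → List ℤ
interval R = map +_ (upTo (suc R)) ++ map -[1+_] (upTo R)

∈-interval : ∀ R {p} → Within R p → p ∈ interval R
∈-interval R       {+ n}      (_ , +≤+ n≤R) = ∈-++⁺ˡ (∈-map⁺ +_ (∈-upTo⁺ (s≤s n≤R)))
∈-interval (suc R) { -[1+ n ]} (-≤- n≤R , _) = ∈-++⁺ʳ (map +_ (upTo (suc (suc R)))) (∈-map⁺ -[1+_] (∈-upTo⁺ (s≤s n≤R)))

-- Bounded walks on the integers and loop erasure.

module _ (f : A → ℤ) where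

  -- Both the start and the endpoint are listed, so a repeated value marks a nonempty zero-sum
  -- segment.
  visits : ℤ → List A → List ℤ
  visits p []       = p ∷ []
  visits p (x ∷ xs) = p ∷ visits (p + f x) xs

  length-visits : ∀ p xs → length (visits p xs) ≡ suc (length xs)
  length-visits p []       = refl
  length-visits p (x ∷ xs) = cong suc (length-visits (p + f x) xs)

  -- Distinct positions inject into the interval. The inequality is strict because a walk has one
  -- more position than steps.
  simple-length : ∀ R p xs → Unique (visits p xs) → All (Within R) (visits p xs) →
    length xs ℕ.< length (interval R)
  simple-length R p xs u ws = subst (_≤ length (interval R)) (length-visits p xs)
    (unique-⊆-length u (All.map (∈-interval R) ws))

  -- The positions increase, so a lower bound at the start and an upper bound at the end control all
  -- of them.
  ascending-visits : ∀ R p xs → All (λ x → 0ℤ ℤ.≤ f x) xs → - (+ R) ℤ.≤ p → p + sumBy f xs ℤ.≤ + R →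
    All (Within R) (visits p xs)
  ascending-visits R p []       []       lo hi = (lo , subst (ℤ._≤ _) (ℤₚ.+-identityʳ p) hi) ∷ []
  ascending-visits R p (x ∷ xs) (q ∷ qs) lo hi =
    (lo , ℤₚ.≤-trans (i≤i+nonneg p (sumBy-≥0 f (q ∷ qs))) hi)
    ∷ ascending-visits R (p + f x) xs qs (ℤₚ.≤-trans lo (i≤i+nonneg p q)) (subst (ℤ._≤ _) (sym (ℤₚ.+-assoc p _ _)) hi)

  descending-visits : ∀ R p xs → All (λ x → f x ℤ.≤ 0ℤ) xs → p ℤ.≤ + R → - (+ R) ℤ.≤ p + sumBy f xs →
    All (Within R) (visits p xs)
  descending-visits R p []       []       hi lo = (subst (_ ℤ.≤_) (ℤₚ.+-identityʳ p) lo , hi) ∷ []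
  descending-visits R p (x ∷ xs) (q ∷ qs) hi lo =
    (ℤₚ.≤-trans lo (i+nonpos≤i p (sumBy-≤0 f (q ∷ qs))) , hi)
    ∷ descending-visits R (p + f x) xs qs (ℤₚ.≤-trans (i+nonpos≤i p q) hi) (subst (_ ℤ.≤_) (sym (ℤₚ.+-assoc p _ _)) lo)

  -- Greedy ordering: from a nonpositive partial sum step up, otherwise step down;
  -- once one sign is exhausted the walk is monotone towards its (bounded) endpoint.
  balance : ∀ R p us ds → All (λ x → 0ℤ ℤ.≤ f x) us → All (λ x → f x ℤ.≤ 0ℤ) ds →
    All (Within R ∘ f) us → All (Within R ∘ f) ds →
    Within R p → Within R (p + sumBy f (us ++ ds)) →
    ∃ λ xs → (us ++ ds ↭ xs) × All (Within R) (visits p xs)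
  balance R p us ds us≥0 ds≤0 wus wds (lo , hi) wend with ℤₚ.≤-total p 0ℤ
  balance R p [] ds us≥0 ds≤0 wus wds (lo , hi) wend | inj₁ p≤0 =
    ds , ↭-refl , descending-visits R p ds ds≤0 hi (proj₁ wend)
  balance R p (u ∷ us) ds (u≥0 ∷ us≥0) ds≤0 ((_ , fu≤R) ∷ wus) wds (lo , hi) wend | inj₁ p≤0
    with balance R (p + f u) us ds us≥0 ds≤0 wus wds
      (ℤₚ.≤-trans lo (i≤i+nonneg p u≥0) , ℤₚ.+-mono-≤ p≤0 fu≤R)
      (subst (Within R) (sym (ℤₚ.+-assoc p (f u) _)) wend)
  ... | xs , perm , wxs = u ∷ xs , prep u perm , (lo , hi) ∷ wxs
  balance R p us [] us≥0 ds≤0 wus wds (lo , hi) wend | inj₂ p≥0 =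
    us , ↭ₚ.++-identityʳ us ,
    ascending-visits R p us us≥0 lo (subst (λ zs → p + sumBy f zs ℤ.≤ + R) (Listₚ.++-identityʳ us) (proj₂ wend))
  balance R p us (d ∷ ds) us≥0 (d≤0 ∷ ds≤0) wus ((-R≤fd , _) ∷ wds) (lo , hi) wend | inj₂ p≥0
    with balance R (p + f d) us ds us≥0 ds≤0 wus wds
      (subst (ℤ._≤ (p + f d)) (ℤₚ.+-identityˡ (- (+ R))) (ℤₚ.+-mono-≤ p≥0 -R≤fd) , ℤₚ.≤-trans (i+nonpos≤i p d≤0) hi)
      (subst (Within R) (trans (cong (_+_ p) (sumBy-↭ f (↭ₚ.shift d us ds))) (sym (ℤₚ.+-assoc p (f d) _))) wend)
  ... | xs , perm , wxs = d ∷ xs , ↭-trans (↭ₚ.shift d us ds) (prep d perm) , (lo , hi) ∷ wxs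

  -- Serves to close a loop: if a step from `p` led to `q`, that step and `as` form the loop, and
  -- `bs` is the simple walk left after cutting it out.
  split-at-visit : ∀ R {p q} ys → p ∈ visits q ys → Unique (visits q ys) → All (Within R) (visits q ys) →
    ∃₂ λ as bs → (ys ≡ as ++ bs) × (q + sumBy f as ≡ p) × Unique (visits p bs) × All (Within R) (visits p bs)
  split-at-visit R {q = q} []       (here refl) u ws = [] , [] , refl , ℤₚ.+-identityʳ q , u , ws
  split-at-visit R {q = q} (y ∷ ys) (here refl) u ws = [] , y ∷ ys , refl , ℤₚ.+-identityʳ q , u , ws
  split-at-visit R {q = q} (y ∷ ys) (there p∈) (_ ∷ u) (_ ∷ ws) with split-at-visit R ys p∈ u ws
  ... | as , bs , refl , eq , u′ , ws′ =
    y ∷ as , bs , refl , trans (sym (ℤₚ.+-assoc q (f y) _)) eq , u′ , ws′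

  Block : ℕ → List A → Set
  Block L b = (length b ≤ L) × (sumBy f b ≡ 0ℤ)

  -- The walk is processed from its end, so the tail is already simple when `x` is prepended. Only
  -- `p` can then be a repeated position, and the loop closed by its return becomes a block.
  loop-erase : ∀ R p xs → All (Within R) (visits p xs) →
    ∃₂ λ ys bs → (xs ↭ ys ++ concat bs) × Unique (visits p ys) × All (Within R) (visits p ys)
               × All (Block (length (interval R))) bs
  loop-erase R p [] ws = [] , [] , ↭-refl , [] ∷ [] , ws , []
  loop-erase R p (x ∷ xs) (w ∷ ws) with loop-erase R (p + f x) xs ws
  ... | ys , bs , perm , u , wys , blocks with p ∈ℤ? visits (p + f x) ys

  ... | no p∉ = x ∷ ys , bs , prep x perm , Allₚ.¬Any⇒All¬ _ p∉ ∷ u , w ∷ wys , blocks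
  ... | yes p∈ with split-at-visit R ys p∈ u wys
  ... | as , cs , refl , eq , u′ , wcs =
    cs , (x ∷ as) ∷ bs ,
    ↭-trans (prep x (↭-trans perm (↭-trans (↭-reflexive (Listₚ.++-assoc as cs (concat bs))) (↭ₚ.shifts as cs))))
      (↭-sym (↭ₚ.shift x cs (as ++ concat bs))) ,
    u′ , wcs , (short , zero-sum) ∷ blocks
    where
    -- The strict bound for the simple walk `as ++ cs` leaves room for the extra step `x`.
    short : suc (length as) ≤ length (interval R)
    short = ℕₚ.≤-trans (s≤s (subst (length as ≤_) (sym (Listₚ.length-++ as)) (ℕₚ.m≤m+n _ _)))
              (simple-length R (p + f x) (as ++ cs) u wys)
    zero-sum : f x + sumBy f as ≡ 0ℤ
    zero-sum = identityʳ-unique p _ (trans (sym (ℤₚ.+-assoc p (f x) _)) eq)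

  -- Elements are separated by sign, interleaved by `balance` starting at zero, and the resulting
  -- walk is loop-erased; the remainder `ys` is a simple walk, hence short.
  block-decomposition : ∀ R xs → All (Within R ∘ f) xs → Within R (sumBy f xs) →
    ∃₂ λ ys bs → (xs ↭ ys ++ concat bs) × (length ys ≤ length (interval R))
               × All (Block (length (interval R))) bs
  block-decomposition R xs wxs wsum
    with balance R 0ℤ (filter pos? xs) (filter (¬? ∘ pos?) xs)
           (Allₚ.all-filter pos? xs) (All.map (ℤₚ.<⇒≤ ∘ ℤₚ.≰⇒>) (Allₚ.all-filter (¬? ∘ pos?) xs))
           (Allₚ.filter⁺ pos? wxs) (Allₚ.filter⁺ (¬? ∘ pos?) wxs) (within-0 R)
           (subst (Within R) (trans (sumBy-↭ f (filter-split pos? xs)) (sym (ℤₚ.+-identityˡ _))) wsum)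
    where
    pos? : Decidable (λ x → 0ℤ ℤ.≤ f x)
    pos? x = 0ℤ ℤ.≤? f x
  ... | xs′ , perm , ws with loop-erase R 0ℤ xs′ ws
  ... | ys , bs , perm′ , u , wys , blocks =
    ys , bs , ↭-trans (filter-split _ xs) (↭-trans perm perm′) , ℕₚ.<⇒≤ (simple-length R 0ℤ ys u wys) , blocks

-- Zero-sum remainders in several coordinates.

-- `L` bounds both the leftover simple walk and the size of each block. A block sums to at most
-- `L * R` in absolute value, and the total over the blocks is the old total minus that of the
-- leftover, so `R + L * R` covers both in the next dimension. Each block discarded there costs at
-- most `L` elements.
remainderBound : ℕ → ℕ → ℕ
remainderBound zero    R = 0
remainderBound (suc d) R = L ℕ.+ remainderBound d (R ℕ.+ L ℕ.* R) ℕ.* L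
  where L = length (interval R)

-- Induction on the number of functions: blocks on which the first function vanishes
-- become the elements of a new instance for the remaining ones.
zero-sum-remainder : ∀ d R (fs : List (A → ℤ)) (xs : List A) → length fs ≤ d →
  All (λ f → All (Within R ∘ f) xs) fs → All (λ f → Within R (sumBy f xs)) fs →
  ∃₂ λ ys zs → (xs ↭ ys ++ zs) × (length ys ≤ remainderBound d R) × All (λ f → sumBy f zs ≡ 0ℤ) fs
zero-sum-remainder d       R []       xs _       _          _            = [] , xs , ↭-refl , z≤n , []
zero-sum-remainder (suc d) R (f ∷ fs) xs (s≤s l) (wf ∷ wfs) (sf ∷ sfs)
  with block-decomposition f R xs wf sf
... | ys , bs , perm , ys≤L , blocks
  with zero-sum-remainder d (R ℕ.+ L ℕ.* R) (map sumBy fs) bs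
         (subst (_≤ d) (sym (Listₚ.length-map sumBy fs)) l)
         (Allₚ.map⁺ (All.map blocks-within wfs))
         (Allₚ.map⁺ (All.zipWith total-within (wfs , sfs)))
  where
  L = length (interval R)
  all-in-perm : ∀ {g} → All (Within R ∘ g) xs → All (Within R ∘ g) (ys ++ concat bs)
  all-in-perm = ↭ₚ.All-resp-↭ perm
  blocks-within : ∀ {g} → All (Within R ∘ g) xs → All (Within (R ℕ.+ L ℕ.* R) ∘ sumBy g) bs
  blocks-within {g} wg = All.zipWith
    (λ { ((b≤L , _) , wb) → within-mono (ℕₚ.≤-trans (ℕₚ.*-monoˡ-≤ R b≤L) (ℕₚ.m≤n+m _ R)) (sumBy-within R g wb) })
    (blocks , Allₚ.concat⁻ (Allₚ.++⁻ʳ ys (all-in-perm wg)))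
  total-within : ∀ {g} → All (Within R ∘ g) xs × Within R (sumBy g xs) → Within (R ℕ.+ L ℕ.* R) (sumBy (sumBy g) bs)
  total-within {g} (wg , sg) = subst (Within _) eq
    (within-+ R (L ℕ.* R) sg (within-neg (L ℕ.* R)
      (within-mono (ℕₚ.*-monoˡ-≤ R ys≤L) (sumBy-within R g (Allₚ.++⁻ˡ ys (all-in-perm wg))))))
    where
    open ≡-Reasoning
    Y = sumBy g ys
    B = sumBy (sumBy g) bs
    eq : sumBy g xs + - Y ≡ B
    eq = begin
      sumBy g xs + - Y                    ≡⟨ cong (_+ - Y) (sumBy-↭ g perm) ⟩
      sumBy g (ys ++ concat bs) + - Y     ≡⟨ cong (_+ - Y) (sumBy-++ g ys (concat bs)) ⟩
      Y + sumBy g (concat bs) + - Y       ≡⟨ cong (λ s → Y + s + - Y) (sumBy-concat g bs) ⟩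
      Y + B + - Y                         ≡⟨ xyx⁻¹≈y Y B ⟩
      B                                   ∎
... | bs₁ , bs₂ , bperm , bs₁≤ , zeros =
  ys ++ concat bs₁ , concat bs₂ ,
  ↭-trans perm (↭-trans (↭ₚ.++⁺ˡ ys (↭-trans (concat-↭ bperm) (↭-reflexive (sym (Listₚ.concat-++ bs₁ bs₂)))))
    (↭-reflexive (sym (Listₚ.++-assoc ys (concat bs₁) (concat bs₂))))) ,
  subst (_≤ _) (sym (Listₚ.length-++ ys))
    (ℕₚ.+-mono-≤ ys≤L (ℕₚ.≤-trans (length-concat-≤ L bs₁ (All.map proj₁ (Allₚ.++⁻ˡ bs₁ blocks′))) (ℕₚ.*-monoˡ-≤ L bs₁≤))) ,
  -- The coordinate `f` vanishes on every block separately, so its sum stays zero whichever blocks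
  -- are discarded.
  trans (sumBy-concat f bs₂) (sumBy-zero (All.map proj₂ (Allₚ.++⁻ʳ bs₁ blocks′)))
  ∷ All.map (λ {g} eq → trans (sumBy-concat g bs₂) eq) (Allₚ.map⁻ zeros)
  where
  L = length (interval R)
  blocks′ : All (Block f L) (bs₁ ++ bs₂)
  blocks′ = ↭ₚ.All-resp-↭ bperm blocks
  sumBy-zero : ∀ {cs} → All (λ c → sumBy f c ≡ 0ℤ) cs → sumBy (sumBy f) cs ≡ 0ℤ
  sumBy-zero []       = refl
  sumBy-zero (e ∷ es) = cong₂ _+_ e (sumBy-zero es)

-- Pigeonhole and Ramsey's theorem.

length-filter-filter : {P Q : Pred A 0ℓ} (P? : Decidable P) (Q? : Decidable Q) (xs : List A) →
  length (filter P? (filter Q? xs)) ≤ length (filter P? xs)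
length-filter-filter P? Q? [] = z≤n
length-filter-filter P? Q? (x ∷ xs) with ih ← length-filter-filter P? Q? xs | does (Q? x)
length-filter-filter P? Q? (x ∷ xs) | true with does (P? x)
... | true  = s≤s ih
... | false = ih
length-filter-filter P? Q? (x ∷ xs) | false with does (P? x)
... | true  = ℕₚ.m≤n⇒m≤1+n ih
... | false = ih

pigeonhole : (c : A → ℕ) (m t : ℕ) (xs : List A) → All (λ x → c x < m) xs → m ℕ.* t < length xs →
  ∃ λ i → t < length (filter (λ x → c x ℕ.≟ i) xs)
pigeonhole c zero    t (x ∷ xs) (() ∷ _) _
pigeonhole c (suc m) t xs       c<1+m     long with t ℕₚ.<? length (filter (λ x → c x ℕ.≟ m) xs)
... | yes t<  = m , t<
... | no  t≮ with pigeonhole c m t others others<m others-long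
  where
  is-m? : Decidable (λ x → c x ≡ m)
  is-m? x = c x ℕ.≟ m
  others = filter (¬? ∘ is-m?) xs
  others<m : All (λ x → c x < m) others
  others<m = All.zipWith (λ { (c< , c≢m) → ℕₚ.≤∧≢⇒< (ℕₚ.≤-pred c<) c≢m })
    (Allₚ.filter⁺ (¬? ∘ is-m?) c<1+m , Allₚ.all-filter (¬? ∘ is-m?) xs)
  length-split : length xs ≡ length (filter is-m? xs) ℕ.+ length others
  length-split = trans (↭ₚ.↭-length (filter-split is-m? xs)) (Listₚ.length-++ (filter is-m? xs))
  others-long : m ℕ.* t < length others
  others-long = ℕₚ.+-cancelˡ-< t _ _ (ℕₚ.<-≤-trans (subst (_ <_) length-split long)
    (ℕₚ.+-monoˡ-≤ (length others) (ℕₚ.≮⇒≥ t≮)))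
... | i , t< = i , ℕₚ.<-≤-trans t< (length-filter-filter (λ x → c x ℕ.≟ i) (λ x → ¬? (c x ℕ.≟ m)) xs)

-- One successor pays for the pivot, the other for the strict inequality that `pigeonhole` asks for.
endHomogeneousBound : ℕ → ℕ → ℕ
endHomogeneousBound M zero    = 0
endHomogeneousBound M (suc s) = suc (suc (M ℕ.* endHomogeneousBound M s))

-- The least number of elements that forces one of `M` colours to occur more than `k` times. It also
-- caps the clique size, and with it the number of coordinates to balance.
ramseySize : ℕ → ℕ → ℕ
ramseySize M k = suc (M ℕ.* k)

module _ (colour : A → A → ℕ) (M : ℕ) (colour<M : ∀ x y → colour x y < M) where

  -- Each element carries the common colour of its pairs with all later elements.
  EndHomogeneous : List (A × ℕ) → Set
  EndHomogeneous = AllPairs (λ p q → colour (proj₁ p) (proj₁ q) ≡ proj₂ p)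

  -- The pivot `x` colours all later elements, and the recursion stays inside one large colour
  -- class. Discarded elements are kept in `rest`, since they return as outside vertices.
  ∃-endHomogeneous : ∀ s xs → endHomogeneousBound M s ≤ length xs →
    ∃₂ λ ps rest → (length ps ≡ s) × EndHomogeneous ps × All (λ p → proj₂ p < M) ps
                 × (xs ↭ map proj₁ ps ++ rest)
  ∃-endHomogeneous zero    xs       _          = [] , xs , refl , [] , [] , ↭-refl
  ∃-endHomogeneous (suc s) (x ∷ xs) (s≤s long)
    with pigeonhole (colour x) M (endHomogeneousBound M s) xs (All.universal (colour<M x) xs) long
  ... | c , large with ∃-endHomogeneous s (filter (λ y → colour x y ℕ.≟ c) xs) (ℕₚ.<⇒≤ large)
  ... | ps , rest , len , hom , ps<M , perm =
    (x , c) ∷ ps , rest ++ filter (¬? ∘ c?) xs , cong suc len ,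
    Allₚ.map⁻ (Allₚ.++⁻ˡ (map proj₁ ps) (↭ₚ.All-resp-↭ perm (Allₚ.all-filter c? xs))) ∷ hom ,
    c<M ∷ ps<M ,
    prep x (↭-trans (filter-split c? xs)
      (↭-trans (↭ₚ.++⁺ʳ _ perm) (↭-reflexive (Listₚ.++-assoc (map proj₁ ps) rest _))))
    where
    c? : Decidable (λ y → colour x y ≡ c)
    c? y = colour x y ℕ.≟ c
    -- `pigeonhole` returns a colour without bounding it; a member of the nonempty class attains it,
    -- which gives the bound.
    attained : ∀ {N} ys → All (λ y → colour x y ≡ c) ys → N < length ys → c < M
    attained (y ∷ _) (refl ∷ _) _ = colour<M x y
    c<M : c < M
    c<M = attained (filter c? xs) (Allₚ.all-filter c? xs) large

  -- The colour of a pair is recorded at its earlier element, so a second `pigeonhole`, on the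
  -- recorded colours, yields a monochromatic set.
  ramsey : ∀ k xs → endHomogeneousBound M (ramseySize M k) ≤ length xs →
    ∃₂ λ K rest → ∃ λ c → (k < length K) × (length K ≤ ramseySize M k)
      × AllPairs (λ x y → colour x y ≡ c) K × (xs ↭ K ++ rest)
  ramsey k xs long with ∃-endHomogeneous (ramseySize M k) xs long
  ... | ps , rest , len , hom , ps<M , perm
    with pigeonhole proj₂ M k ps ps<M (subst (M ℕ.* k <_) (sym len) ℕₚ.≤-refl)
  ... | c , large =
    map proj₁ qs , map proj₁ (filter (¬? ∘ c?) ps) ++ rest , c ,
    subst (k <_) (sym (Listₚ.length-map proj₁ qs)) large ,
    subst (_≤ ramseySize M k) (sym (Listₚ.length-map proj₁ qs)) (ℕₚ.≤-trans (Listₚ.length-filter c? ps) (ℕₚ.≤-reflexive len)) ,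
    AllPairsₚ.map⁺ (recolour (Allₚ.all-filter c? ps) (AllPairsₚ.filter⁺ c? hom)) ,
    ↭-trans perm (↭-trans (↭ₚ.++⁺ʳ rest (↭-trans (↭ₚ.map⁺ proj₁ (filter-split c? ps))
        (↭-reflexive (Listₚ.map-++ proj₁ qs _)))) (↭-reflexive (Listₚ.++-assoc (map proj₁ qs) _ rest)))
    where
    c? : Decidable (λ (p : A × ℕ) → proj₂ p ≡ c)
    c? p = proj₂ p ℕ.≟ c
    qs = filter c? ps
    recolour : ∀ {zs} → All (λ p → proj₂ p ≡ c) zs → EndHomogeneous zs →
      AllPairs (λ p q → colour (proj₁ p) (proj₁ q) ≡ c) zs
    recolour []         []         = []
    recolour (e ∷ es) (h ∷ hs) = All.map (λ eq → trans eq e) h ∷ recolour es hs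

-- Pairwise relations, and passing between lists and subsets.

allPairs-++⁻ : {R : Rel A 0ℓ} (xs : List A) {ys : List A} → AllPairs R (xs ++ ys) →
  AllPairs R xs × All (λ x → All (R x) ys) xs
allPairs-++⁻ []       _          = [] , []
allPairs-++⁻ (x ∷ xs) (rx ∷ rxs) with allPairs-++⁻ xs rxs
... | pairs , cross = Allₚ.++⁻ˡ xs rx ∷ pairs , Allₚ.++⁻ʳ xs rx ∷ cross

-- `AllPairs` relates elements in list order only; symmetry supplies the elements that precede `v`.
allPairs-lookup : {R : Rel A 0ℓ} → Symmetric R → {xs : List A} → AllPairs R xs → ∀ {v} → v ∈ xs →
  All (λ u → u ≢ v → R v u) xs
allPairs-lookup sym (rx ∷ rxs) (here refl) = (λ x≢x → contradiction refl x≢x) ∷ All.map (λ r _ → r) rx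
allPairs-lookup sym (rx ∷ rxs) (there v∈)  = (λ _ → sym (All.lookup rx v∈)) ∷ allPairs-lookup sym rxs v∈

unique-resp-↭ : {xs ys : List A} → xs ↭ ys → Unique xs → Unique ys
unique-resp-↭ {A = A} p = ↭ₛₚ.Unique-resp-↭ (setoid A) (↭⇒↭ₛ p)

↭-refine : ∀ {xs rest ys zs : List A} ws → xs ↭ ws ++ rest → rest ↭ ys ++ zs → xs ↭ (ws ++ zs) ++ ys
↭-refine {ys = ys} {zs} ws p q = ↭-trans p (↭-trans (↭ₚ.++⁺ˡ ws (↭-trans q (↭ₚ.++-comm ys zs)))
  (↭-reflexive (sym (Listₚ.++-assoc ws zs ys))))

-- The embedding `g` is general so that the induction passes to the tail, where `id` becomes
-- `Fin.suc`.
length-filter-tabulate : ∀ {m n} (T : Subset m) (g : Fin n → Fin m) (S : Subset n) →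
  (∀ i → lookup T (g i) ≡ lookup S i) →
  length (filter (λ j → lookup T j Bool.≟ true) (tabulate g)) ≡ ∣ S ∣
length-filter-tabulate T g Vec.[]      _  = refl
length-filter-tabulate T g (b Vec.∷ S) eq rewrite eq Fin.zero with b
... | true  = cong suc (length-filter-tabulate T (g ∘ Fin.suc) S (eq ∘ Fin.suc))
... | false = length-filter-tabulate T (g ∘ Fin.suc) S (eq ∘ Fin.suc)

length-members : ∀ {n} (S : Subset n) → length (members S) ≡ ∣ S ∣
length-members S = length-filter-tabulate S id S (λ _ → refl)

-- As `allFin n` has no repetitions, `xs` and `ys` are disjoint, and membership in `xs` is the
-- characteristic vector. This turns the list surgery back into an induced subgraph.
∃-subset : ∀ {n} (xs ys : List (Fin n)) → allFin n ↭ xs ++ ys → ∃ λ S → members S ↭ xs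
∃-subset {n} xs ys perm = S ,
  ↭-trans (↭ₚ.filter-↭ in? perm) (↭-reflexive
    (trans (Listₚ.filter-++ in? xs ys) (trans (cong₂ _++_ (Listₚ.filter-all in? all-xs) (Listₚ.filter-none in? none-ys))
      (Listₚ.++-identityʳ xs))))
  where
  open import Data.List.Membership.DecPropositional (_≟_ {n}) using (_∈?_)
  S : Subset n
  S = Vec.tabulate (λ i → does (i ∈? xs))
  in? : Decidable (λ i → lookup S i ≡ true)
  in? i = lookup S i Bool.≟ true
  lookup-S : ∀ i → lookup S i ≡ does (i ∈? xs)
  lookup-S = Vecₚ.lookup∘tabulate _
  all-xs : All (λ i → lookup S i ≡ true) xs
  all-xs = All.tabulate (λ {i} i∈ → trans (lookup-S i) (dec-true (i ∈? xs) i∈))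
  cross : All (λ x → All (x ≢_) ys) xs
  cross = proj₂ (allPairs-++⁻ xs (unique-resp-↭ perm (Uniqueₚ.allFin⁺ n)))
  none-ys : All (λ i → lookup S i ≢ true) ys
  none-ys = All.tabulate (λ {i} i∈ys eq → true≢false (trans (sym eq)
    (trans (lookup-S i) (dec-false (i ∈? xs) (λ i∈xs → All.lookup (All.lookup cross i∈xs) i∈ys refl)))))
    where
    true≢false : true ≢ false
    true≢false ()

-- Estimates for weight differences and degree windows.

within-difference : ∀ R {a b} → a ≤ b ℕ.+ R → b ≤ a ℕ.+ R → Within R (+ a ℤ.- + b)
within-difference R {a} {b} a≤ b≤ =
  subst (- (+ R) ℤ.≤_) (⁻¹-anti-homo‿- (+ b) (+ a)) (ℤₚ.neg-mono-≤ (upper b a b≤)) , upper a b a≤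
  where
  upper : ∀ x y → x ≤ y ℕ.+ R → + x ℤ.- + y ℤ.≤ + R
  upper x y x≤ = subst (+ x ℤ.- + y ℤ.≤_) (xyx⁻¹≈y (+ y) (+ R)) (ℤₚ.+-monoˡ-≤ (- (+ y)) (+≤+ x≤))

sumBy-difference : (a b : A → ℕ) (xs : List A) →
  sumBy (λ x → + a x ℤ.- + b x) xs ≡ + sum (map a xs) ℤ.- + sum (map b xs)
sumBy-difference a b []       = refl
sumBy-difference a b (x ∷ xs) = begin
  + a x ℤ.- + b x + sumBy _ xs                   ≡⟨ cong (_+_ (+ a x ℤ.- + b x)) (sumBy-difference a b xs) ⟩
  (+ a x + - (+ b x)) + (+ sa + - (+ sb))        ≡⟨ interchange (+ a x) (- (+ b x)) (+ sa) (- (+ sb)) ⟩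
  (+ a x + + sa) + (- (+ b x) + - (+ sb))        ≡⟨ cong (_+_ (+ a x + + sa)) (sym (ℤₚ.neg-distrib-+ (+ b x) (+ sb))) ⟩
  (+ a x + + sa) ℤ.- (+ b x + + sb)              ∎
  where
  open ≡-Reasoning
  sa = sum (map a xs)
  sb = sum (map b xs)

sum-map-≤ : ∀ r (a : A → ℕ) (xs : List A) → (∀ x → a x ≤ r) → sum (map a xs) ≤ length xs ℕ.* r
sum-map-≤ r a []       _  = z≤n
sum-map-≤ r a (x ∷ xs) a≤ = ℕₚ.+-mono-≤ (a≤ x) (sum-map-≤ r a xs a≤)

sum-map-++ : (a : A → ℕ) (xs ys : List A) → sum (map a (xs ++ ys)) ≡ sum (map a xs) ℕ.+ sum (map a ys)
sum-map-++ a xs ys = trans (cong sum (Listₚ.map-++ a xs ys)) (Sumₚ.sum-++ (map a xs) (map a ys))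

same-quotient-close : ∀ L .{{_ : NonZero L}} {a b} → a / L ≡ b / L → a ≤ b ℕ.+ L
same-quotient-close L {a} {b} eq = begin
  a                       ≡⟨ m≡m%n+[m/n]*n a L ⟩
  a ℕ.% L ℕ.+ a / L ℕ.* L ≤⟨ ℕₚ.+-mono-≤ (m%n≤n a L) (ℕₚ.≤-reflexive (cong (ℕ._* L) eq)) ⟩
  L ℕ.+ b / L ℕ.* L       ≤⟨ ℕₚ.+-monoʳ-≤ L (m/n*n≤m b L) ⟩
  L ℕ.+ b                 ≡⟨ ℕₚ.+-comm L b ⟩
  b ℕ.+ L                 ∎
  where open ℕₚ.≤-Reasoning

-- The quotient counts windows of length 2tr in the range [0, nr] of weighted degrees.
few-windows : ∀ r t n .{{_ : NonZero r}} .{{_ : NonZero (t ℕ.* 2 ℕ.* r)}} → t ℕ.* 2 < n →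
  suc (n ℕ.* r / (t ℕ.* 2 ℕ.* r)) ℕ.* t < n
few-windows r t n 2t<n = ℕₚ.*-cancelʳ-< 2 _ _ (begin-strict
  suc X ℕ.* t ℕ.* 2              ≡⟨ ℕₚ.*-assoc (suc X) t 2 ⟩
  t ℕ.* 2 ℕ.+ X ℕ.* (t ℕ.* 2)    <⟨ ℕₚ.+-mono-<-≤ 2t<n X*2t≤n ⟩
  n ℕ.+ n                        ≡⟨ cong (n ℕ.+_) (sym (ℕₚ.+-identityʳ n)) ⟩
  2 ℕ.* n                        ≡⟨ ℕₚ.*-comm 2 n ⟩
  n ℕ.* 2                        ∎)
  where
  open ℕₚ.≤-Reasoning
  X = n ℕ.* r / (t ℕ.* 2 ℕ.* r)
  X*2t≤n : X ℕ.* (t ℕ.* 2) ≤ n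
  X*2t≤n = ℕₚ.*-cancelʳ-≤ _ _ r (ℕₚ.≤-trans (ℕₚ.≤-reflexive (ℕₚ.*-assoc X (t ℕ.* 2) r)) (m/n*n≤m (n ℕ.* r) (t ℕ.* 2 ℕ.* r)))

≤-foldr-⊔ : (h : A → ℕ) {xs : List A} {v : A} → v ∈ xs → h v ≤ foldr (λ x m → h x ⊔ m) 0 xs
≤-foldr-⊔ h (here refl)        = ℕₚ.m≤m⊔n _ _
≤-foldr-⊔ h {x ∷ xs} (there v∈) = ℕₚ.≤-trans (≤-foldr-⊔ h v∈) (ℕₚ.m≤n⊔m (h x) _)

others? : ∀ {n} (v : Fin n) → Decidable {A = Fin n} (_≢ v)
others? v u = ¬? (u ≟ v)

-- Here `m` caps the clique size and `L` is the window length. A single coordinate difference is at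
-- most `r`; a total over the outside vertices is at most `L + m * r`, where `m * r` allows for
-- weight inside the clique.
deletionBound : ℕ → ℕ → ℕ → ℕ
deletionBound r m L = remainderBound m (r ℕ.+ (L ℕ.+ m ℕ.* r))

-- Degrees in the weighted complete graph.

module _ {n r : ℕ} (W : Weighting n r) where

  wt : Fin n → Fin n → ℕ
  wt v u = toℕ (w W v u)

  wt≤r : ∀ v u → wt v u ≤ r
  wt≤r v u = ℕₚ.≤-pred (Finₚ.toℕ<n (w W v u))

  wt-sym : ∀ v u → wt v u ≡ wt u v
  wt-sym v u = cong toℕ (Weighting.sym W v u)

  -- This includes the diagonal entry wt v v when v ∈ xs; it is bounded, so harmless in the window argument.
  weightInto : List (Fin n) → Fin n → ℕ
  weightInto xs v = sum (map (wt v) xs)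

  weightInto-↭ : ∀ {xs ys} v → xs ↭ ys → weightInto xs v ≡ weightInto ys v
  weightInto-↭ v p = Sumₚ.sum-↭ (↭ₚ.map⁺ (wt v) p)

  weightInto-constant : ∀ {c} v xs → All (λ u → wt v u ≡ c) xs → weightInto xs v ≡ length xs ℕ.* c
  weightInto-constant v []       []       = refl
  weightInto-constant v (x ∷ xs) (e ∷ es) = cong₂ ℕ._+_ e (weightInto-constant v xs es)

  -- c is added on the left so that the degree c * (length K ∸ 1) needs no truncated subtraction.
  clique-degree : ∀ {c v} K → Unique K → v ∈ K → All (λ u → u ≢ v → wt v u ≡ c) K →
    weightInto (filter (others? v) K) v ℕ.+ c ≡ length K ℕ.* c
  clique-degree {c} {v} (_ ∷ K) (v∉K ∷ _) (here refl) (_ ∷ es) = begin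
    weightInto (filter (others? v) (v ∷ K)) v ℕ.+ c
      ≡⟨ cong (λ zs → weightInto zs v ℕ.+ c) (trans (Listₚ.filter-reject (others? v) (λ v≢v → v≢v refl)) (Listₚ.filter-all (others? v) others)) ⟩
    weightInto K v ℕ.+ c
      ≡⟨ cong (ℕ._+ c) (weightInto-constant v K (All.zipWith (λ { (u≢v , e) → e u≢v }) (others , es))) ⟩
    length K ℕ.* c ℕ.+ c
      ≡⟨ ℕₚ.+-comm (length K ℕ.* c) c ⟩
    c ℕ.+ length K ℕ.* c ∎
    where
    open ≡-Reasoning
    others : All (_≢ v) K
    others = All.map (λ v≢u → v≢u ∘ sym) v∉K
  clique-degree {c} {v} (x ∷ K) (x∉K ∷ uK) (there v∈K) (e ∷ es) = begin
    weightInto (filter (others? v) (x ∷ K)) v ℕ.+ c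
      ≡⟨ cong (λ zs → weightInto zs v ℕ.+ c) (Listₚ.filter-accept (others? v) x≢v) ⟩
    wt v x ℕ.+ weightInto (filter (others? v) K) v ℕ.+ c
      ≡⟨ ℕₚ.+-assoc (wt v x) _ c ⟩
    wt v x ℕ.+ (weightInto (filter (others? v) K) v ℕ.+ c)
      ≡⟨ cong₂ ℕ._+_ (e x≢v) (clique-degree K uK v∈K es) ⟩
    c ℕ.+ length K ℕ.* c ∎
    where
    open ≡-Reasoning
    x≢v : x ≢ v
    x≢v = All.lookup x∉K v∈K

  -- Edges inside `K` contribute the same amount to each of its vertices, so on `K` equal weight
  -- into `zs` means equal degree.
  degree-clique : ∀ {c} K zs S → members S ↭ K ++ zs → Unique (K ++ zs) →
    AllPairs (λ x y → wt x y ≡ c) K → ∀ {v} → v ∈ K →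
    degree W S v ℕ.+ c ≡ length K ℕ.* c ℕ.+ weightInto zs v
  degree-clique {c} K zs S perm u mono {v} v∈K = begin
    degree W S v ℕ.+ c
      ≡⟨ cong (ℕ._+ c) (weightInto-↭ v (↭ₚ.filter-↭ (others? v) perm)) ⟩
    weightInto (filter (others? v) (K ++ zs)) v ℕ.+ c
      ≡⟨ cong (λ ys → weightInto ys v ℕ.+ c) (trans (Listₚ.filter-++ (others? v) K zs)
           (cong (filter (others? v) K ++_) (Listₚ.filter-all (others? v) zs≢v))) ⟩
    weightInto (filter (others? v) K ++ zs) v ℕ.+ c
      ≡⟨ cong (ℕ._+ c) (sum-map-++ (wt v) (filter (others? v) K) zs) ⟩
    dK ℕ.+ weightInto zs v ℕ.+ c
      ≡⟨ swapʳ dK (weightInto zs v) c ⟩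
    dK ℕ.+ c ℕ.+ weightInto zs v
      ≡⟨ cong (ℕ._+ weightInto zs v) (clique-degree K (proj₁ uK) v∈K (allPairs-lookup (λ {x} {y} e → trans (wt-sym y x) e) mono v∈K)) ⟩
    length K ℕ.* c ℕ.+ weightInto zs v ∎
    where
    open ≡-Reasoning
    dK = weightInto (filter (others? v) K) v
    uK = allPairs-++⁻ K u
    zs≢v : All (_≢ v) zs
    zs≢v = All.map (λ v≢u → v≢u ∘ sym) (All.lookup (proj₂ uK) v∈K)
    swapʳ : ∀ x y z → x ℕ.+ y ℕ.+ z ≡ x ℕ.+ z ℕ.+ y
    swapʳ = solve-∀

  repetition-≥ : ∀ S K zs → members S ↭ K ++ zs → ∀ {v} → v ∈ K →
    All (λ u → degree W S u ≡ degree W S v) K → length K ≤ repetitionNumber W S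
  repetition-≥ S K zs perm {v} v∈K same = ℕₚ.≤-trans |K|≤mult
    (≤-foldr-⊔ (λ u → multiplicity W S (degree W S u)) (↭ₚ.∈-resp-↭ (↭-sym perm) (∈-++⁺ˡ v∈K)))
    where
    same? : Decidable (λ u → degree W S u ≡ degree W S v)
    same? u = degree W S u ℕ.≟ degree W S v
    open ℕₚ.≤-Reasoning
    |K|≤mult : length K ≤ multiplicity W S (degree W S v)
    |K|≤mult = begin
      length K                                          ≤⟨ ℕₚ.m≤m+n _ _ ⟩
      length K ℕ.+ length (filter same? zs)             ≡⟨ cong (λ xs → length xs ℕ.+ length (filter same? zs)) (sym (Listₚ.filter-all same? same)) ⟩
      length (filter same? K) ℕ.+ length (filter same? zs) ≡⟨ sym (Listₚ.length-++ (filter same? K)) ⟩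
      length (filter same? K ++ filter same? zs)        ≡⟨ cong length (sym (Listₚ.filter-++ same? K zs)) ⟩
      length (filter same? (K ++ zs))                   ≡⟨ sym (↭ₚ.↭-length (↭ₚ.filter-↭ same? perm)) ⟩
      multiplicity W S (degree W S v)                   ∎

  equalise : ∀ m L {c v₀} K rest → allFin n ↭ K ++ rest → length K ≤ m → v₀ ∈ K →
    AllPairs (λ x y → wt x y ≡ c) K →
    (∀ {u v} → u ∈ K → v ∈ K → weightInto (allFin n) u ≤ weightInto (allFin n) v ℕ.+ L) →
    ∃ λ S → (n ∸ deletionBound r m L ≤ ∣ S ∣) × (length K ≤ repetitionNumber W S)
  equalise m L {c} {v₀} K rest perm |K|≤m v₀∈K mono close
    with zero-sum-remainder m (r ℕ.+ (L ℕ.+ m ℕ.* r)) (map difference K) rest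
           (subst (_≤ m) (sym (Listₚ.length-map difference K)) |K|≤m)
           (Allₚ.map⁺ (All.universal (λ v → All.universal (pointwise v) rest) K))
           (Allₚ.map⁺ (All.tabulate total))
    where
    R = r ℕ.+ (L ℕ.+ m ℕ.* r)
    -- Zero sum over `zs` says that `v` and `v₀` have equal weight into `zs`. The coordinate of `v₀`
    -- is identically zero, so all of `K` can be mapped uniformly.
    difference : Fin n → Fin n → ℤ
    difference v u = + wt v u ℤ.- + wt v₀ u
    pointwise : ∀ v u → Within R (difference v u)
    pointwise v u = within-difference R (bound v v₀) (bound v₀ v)
      where
      bound : ∀ x y → wt x u ≤ wt y u ℕ.+ R
      bound x y = ℕₚ.≤-trans (wt≤r x u) (ℕₚ.≤-trans (ℕₚ.m≤m+n r _) (ℕₚ.m≤n+m R (wt y u)))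
    split : ∀ v → weightInto (allFin n) v ≡ weightInto K v ℕ.+ weightInto rest v
    split v = trans (weightInto-↭ v perm) (sum-map-++ (wt v) K rest)
    -- Restricting from all vertices to `rest` costs only the weight into `K`, at most `m * r`.
    rest-close : ∀ {u v} → u ∈ K → v ∈ K → weightInto rest u ≤ weightInto rest v ℕ.+ R
    rest-close {u} {v} u∈K v∈K = begin
      weightInto rest u                                      ≤⟨ ℕₚ.m≤n+m _ _ ⟩
      weightInto K u ℕ.+ weightInto rest u                   ≡⟨ sym (split u) ⟩
      weightInto (allFin n) u                                ≤⟨ close u∈K v∈K ⟩
      weightInto (allFin n) v ℕ.+ L                          ≡⟨ cong (ℕ._+ L) (split v) ⟩
      weightInto K v ℕ.+ weightInto rest v ℕ.+ L             ≤⟨ ℕₚ.+-monoˡ-≤ L (ℕₚ.+-monoˡ-≤ (weightInto rest v) K≤) ⟩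
      m ℕ.* r ℕ.+ weightInto rest v ℕ.+ L                    ≡⟨ regroup (m ℕ.* r) (weightInto rest v) L ⟩
      weightInto rest v ℕ.+ (L ℕ.+ m ℕ.* r)                  ≤⟨ ℕₚ.+-monoʳ-≤ (weightInto rest v) (ℕₚ.m≤n+m _ r) ⟩
      weightInto rest v ℕ.+ R                                ∎
      where
      open ℕₚ.≤-Reasoning
      K≤ : weightInto K v ≤ m ℕ.* r
      K≤ = ℕₚ.≤-trans (sum-map-≤ r (wt v) K (wt≤r v)) (ℕₚ.*-monoˡ-≤ r |K|≤m)
      regroup : ∀ x y z → x ℕ.+ y ℕ.+ z ≡ y ℕ.+ (z ℕ.+ x)
      regroup = solve-∀
    total : ∀ {v} → v ∈ K → Within R (sumBy (difference v) rest)
    total {v} v∈K = subst (Within R) (sym (sumBy-difference (wt v) (wt v₀) rest))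
      (within-difference R (rest-close v∈K v₀∈K) (rest-close v₀∈K v∈K))
  ... | ys , zs , rperm , ys≤ , zeros with ∃-subset (K ++ zs) ys (↭-refine K perm rperm)
  ... | S , mperm = S , size , repetition-≥ S K zs mperm v₀∈K (All.tabulate same)
    where
    full : allFin n ↭ (K ++ zs) ++ ys
    full = ↭-refine K perm rperm
    unique : Unique (K ++ zs)
    unique = proj₁ (allPairs-++⁻ (K ++ zs) (unique-resp-↭ full (Uniqueₚ.allFin⁺ n)))
    |S| : ∣ S ∣ ≡ length (K ++ zs)
    |S| = trans (sym (length-members S)) (↭ₚ.↭-length mperm)
    n≡ : n ≡ length (K ++ zs) ℕ.+ length ys
    n≡ = trans (sym (Listₚ.length-tabulate {n = n} id)) (trans (↭ₚ.↭-length full) (Listₚ.length-++ (K ++ zs)))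
    size : n ∸ deletionBound r m L ≤ ∣ S ∣
    size = ℕₚ.m≤n+o⇒m∸n≤o n _ (begin
      n                                        ≡⟨ n≡ ⟩
      length (K ++ zs) ℕ.+ length ys           ≡⟨ cong (ℕ._+ length ys) (sym |S|) ⟩
      ∣ S ∣ ℕ.+ length ys                      ≤⟨ ℕₚ.+-monoʳ-≤ ∣ S ∣ ys≤ ⟩
      ∣ S ∣ ℕ.+ deletionBound r m L               ≡⟨ ℕₚ.+-comm ∣ S ∣ _ ⟩
      deletionBound r m L ℕ.+ ∣ S ∣               ∎)
      where open ℕₚ.≤-Reasoning
    equal-outside : ∀ {v} → v ∈ K → weightInto zs v ≡ weightInto zs v₀
    equal-outside {v} v∈K = ℤₚ.+-injective (x∙y⁻¹≈ε⇒x≈y _ _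
      (trans (sym (sumBy-difference (wt v) (wt v₀) zs)) (All.lookup (Allₚ.map⁻ zeros) v∈K)))
    same : ∀ {v} → v ∈ K → degree W S v ≡ degree W S v₀
    same {v} v∈K = ℕₚ.+-cancelʳ-≡ c _ _ (trans (degree-clique K zs S mperm unique mono v∈K)
      (trans (cong (length K ℕ.* c ℕ.+_) (equal-outside v∈K)) (sym (degree-clique K zs S mperm unique mono v₀∈K))))

  CloseClique : ℕ → ℕ → Set
  CloseClique k L = ∃₂ λ K rest → ∃ λ c → (k < length K) × (length K ≤ ramseySize (suc r) k)
    × AllPairs (λ x y → wt x y ≡ c) K × (allFin n ↭ K ++ rest)
    × (∀ {u v} → u ∈ K → v ∈ K → weightInto (allFin n) u ≤ weightInto (allFin n) v ℕ.+ L)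

  -- There are so few windows of length `t * 2 * r` that one holds more than `t` vertices, enough
  -- for `ramsey`. The window length does not involve `n`, so neither does the closeness obtained.
  ∃-close-clique : ∀ k t .{{_ : NonZero (t ℕ.* 2 ℕ.* r)}} .{{_ : NonZero r}} →
    endHomogeneousBound (suc r) (ramseySize (suc r) k) ≤ t →
    t ℕ.* 2 < n →
    CloseClique k (t ℕ.* 2 ℕ.* r)
  ∃-close-clique k t bound 2t<n
    with pigeonhole window (suc (n ℕ.* r / L)) t (allFin n) (All.universal window< (allFin n))
           (subst (suc (n ℕ.* r / L) ℕ.* t <_) (sym (Listₚ.length-tabulate {n = n} id)) (few-windows r t n 2t<n))
    where
    L = t ℕ.* 2 ℕ.* r
    window : Fin n → ℕ
    window v = weightInto (allFin n) v / L
    window< : ∀ v → window v < suc (n ℕ.* r / L)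
    window< v = s≤s (/-monoˡ-≤ L (subst (λ l → weightInto (allFin n) v ≤ l ℕ.* r) (Listₚ.length-tabulate {n = n} id)
      (sum-map-≤ r (wt v) (allFin n) (wt≤r v))))
  ... | i , large with ramsey wt (suc r) (λ v u → s≤s (wt≤r v u)) k _ (ℕₚ.≤-trans bound (ℕₚ.<⇒≤ large))
  ... | K , rest , c , k< , K≤ , mono , perm =
    K , rest ++ filter (¬? ∘ i?) (allFin n) , c , k< , K≤ , mono ,
    ↭-trans (filter-split i? (allFin n)) (↭-trans (↭ₚ.++⁺ʳ _ perm) (↭-reflexive (Listₚ.++-assoc K rest _))) ,
    λ u∈K v∈K → same-quotient-close (t ℕ.* 2 ℕ.* r) (trans (All.lookup in-window u∈K) (sym (All.lookup in-window v∈K)))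
    where
    i? : Decidable (λ v → weightInto (allFin n) v / (t ℕ.* 2 ℕ.* r) ≡ i)
    i? v = weightInto (allFin n) v / (t ℕ.* 2 ℕ.* r) ℕ.≟ i
    in-window : All (λ v → weightInto (allFin n) v / (t ℕ.* 2 ℕ.* r) ≡ i) K
    in-window = Allₚ.++⁻ˡ K (↭ₚ.All-resp-↭ perm (Allₚ.all-filter i? (allFin n)))

  equalise-clique : ∀ k L → CloseClique k L →
    ∃ λ S → (n ∸ deletionBound r (ramseySize (suc r) k) L ≤ ∣ S ∣) × (k ≤ repetitionNumber W S)
  -- `k < length K` excludes the empty list, and the head becomes the base vertex.
  equalise-clique k L (v₀ ∷ K , rest , c , k< , K≤ , mono , perm , close) =
    Product.map₂ (Product.map₂ (ℕₚ.≤-trans (ℕₚ.<⇒≤ k<)))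
      (equalise (ramseySize (suc r) k) L (v₀ ∷ K) rest perm K≤ (here refl) mono close)

-- Choice of constants and small orders.

bounded-deletion : ∀ k r t .{{_ : NonZero r}} .{{_ : NonZero (t ℕ.* 2 ℕ.* r)}} →
  endHomogeneousBound (suc r) (ramseySize (suc r) k) ≤ t →
  (n : ℕ) (W : Weighting n r) → t ℕ.* 2 < n →
  Σ (Subset n) λ S → (n ∸ deletionBound r (ramseySize (suc r) k) (t ℕ.* 2 ℕ.* r) ≤ ∣ S ∣) × (k ≤ repetitionNumber W S)
bounded-deletion k r t bound≤t n W 2t<n =
  equalise-clique W k (t ℕ.* 2 ℕ.* r) (∃-close-clique W k t bound≤t 2t<n)

-- With `C = N + D`, orders up to `N` make `n ∸ C` vanish, so the empty subset suffices; for larger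
-- orders, raising `D` to `C` only weakens the claim.
absorb-small-orders : ∀ k r N D →
  ((n : ℕ) (W : Weighting n r) → N < n → Σ (Subset n) λ S → (n ∸ D ≤ ∣ S ∣) × (k ≤ repetitionNumber W S)) →
  Σ ℕ λ C → (n : ℕ) → (W : Weighting n r) →
  Σ (Subset n) λ S → (n ∸ C ≤ ∣ S ∣) × (k ⊓ (n ∸ C) ≤ repetitionNumber W S)
absorb-small-orders k r N D large = N ℕ.+ D , λ n W → choose n W (n ℕₚ.≤? N)
  where
  choose : (n : ℕ) (W : Weighting n r) → Dec (n ≤ N) →
    Σ (Subset n) λ S → (n ∸ (N ℕ.+ D) ≤ ∣ S ∣) × (k ⊓ (n ∸ (N ℕ.+ D)) ≤ repetitionNumber W S)
  choose n W (yes n≤N) = Subset.⊥ , ℕₚ.≤-trans n∸C≤0 z≤n , ℕₚ.≤-trans (ℕₚ.m⊓n≤n k _) (ℕₚ.≤-trans n∸C≤0 z≤n)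
    where
    n∸C≤0 : n ∸ (N ℕ.+ D) ≤ 0
    n∸C≤0 = ℕₚ.≤-reflexive (ℕₚ.m≤n⇒m∸n≡0 (ℕₚ.≤-trans n≤N (ℕₚ.m≤m+n N D)))
  choose n W (no n≰N) with large n W (ℕₚ.≰⇒> n≰N)
  ... | S , size , repeated =
    S , ℕₚ.≤-trans (ℕₚ.∸-monoʳ-≤ n (ℕₚ.m≤n+m D N)) size , ℕₚ.≤-trans (ℕₚ.m⊓n≤m k _) repeated

theorem1p1 : (k r : ℕ) → 1 ≤ k → 1 ≤ r →
    Σ ℕ λ C → (n : ℕ) → (W : Weighting n r) →
    Σ (Subset n) λ S →
    (n ∸ C ≤ ∣ S ∣) × (k ⊓ (n ∸ C) ≤ repetitionNumber W S)
theorem1p1 k r@(suc _) _ _ =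
  absorb-small-orders k r (t ℕ.* 2) (deletionBound r (ramseySize (suc r) k) (t ℕ.* 2 ℕ.* r))
    (bounded-deletion k r t (ℕₚ.n≤1+n _))
  where
  t : ℕ
  -- The successor makes `t * 2 * r` compute to a successor, so the division by the window length is
  -- defined.
  t = suc (endHomogeneousBound (suc r) (ramseySize (suc r) k))
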